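{- If $M_1$ and $M_2$ are matroids then for all integers $k>0$ $$\chi^k_{M_1\oplus M_2}(t_1,\dots,t_k)=\chi^k_{M_1}(t_1,\dots,t_k)\,\chi^k_{M_2}(t_1,\dots,t_k).$$
   Context: A matroid $M=(\mathcal{A},\mathrm{rk})$ is given by a finite ground set $\mathcal{A}$ and its rank function $\mathrm{rk}$; $\mathrm{rk}(M)=\mathrm{rk}(\mathcal{A})$. For $k\ge 1$ let $\mathcal{C}^k_{\mathcal{A}}=\{(A_1,\dots,A_k)\in(2^{\mathcal{A}})^k \mid A_1\subseteq A_2\subseteq\cdots\subseteq A_k\subseteq\mathcal{A}\}$ (inclusions need not be strict). The $k$th chain characteristic polynomial is $\chi_M^k(t_1,\dots,t_k)=\sum_{(A_i)\in\mathcal{C}^k_{\mathcal{A}}}\prod_{i=1}^k(-1)^{|A_i|}t_i^{\mathrm{rk}(M)-\mathrm{rk}(A_i)}$. For $M_1=(\mathcal{A}_1,\mathrm{rk}_1)$ and $M_2=(\mathcal{A}_2,\mathrm{rk}_2)$, the direct sum $M_1\oplus M_2$ is the matroid on $\mathcal{A}_1\sqcup\mathcal{A}_2$ with rank function $A\mapsto \mathrm{rk}_1(A\cap\mathcal{A}_1)+\mathrm{rk}_2(A\cap\mathcal{A}_2)$. -}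

module Defs where

open import Algebra.Bundles using (RawRing)
import Algebra.Definitions.RawSemiring as RawSemiringDefinitions
open import Data.Bool.Base using (true; false)
open import Data.Fin.Base using (Fin; zero; suc)
open import Data.Fin.Subset using (Subset; inside; outside; _⊆_; _∪_; _∩_; ∣_∣; ⊤)
open import Data.Fin.Subset.Properties using (_⊆?_; drop-∷-⊆)
open import Data.Integer.Base as ℤ using (ℤ; 0ℤ; 1ℤ)
open import Data.List.Base as List using (List; []; _∷_)
open import Data.Nat.Base as ℕ using (ℕ; zero; suc; _≤_; z≤n; s≤s; _∸_)
import Data.Nat.Properties as ℕ
open import Algebra.Properties.CommutativeSemigroup ℕ.+-commutativeSemigroup using (interchange)
open import Data.Product.Base using (_×_; _,_; proj₁; proj₂)
open import Data.Vec.Base as Vec using (Vec; []; _∷_; take; drop; lookup; replicate; _[_]≔_; here; there)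
open import Data.Vec.Properties using (≡-dec; take-zipWith; drop-zipWith)
open import Data.Vec.Relation.Unary.Linked using (Linked; linked?)
open import Level using (0ℓ)
open import Relation.Binary.PropositionalEquality using (_≡_; refl; cong; cong₂)

-- A matroid whose ground set is Fin n.

record Matroid (n : ℕ) : Set where
  field
    rk            : Subset n → ℕ
    rk-card       : ∀ A → rk A ≤ ∣ A ∣
    rk-mono       : ∀ {A B} → A ⊆ B → rk A ≤ rk B
    rk-submodular : ∀ A B → rk (A ∪ B) ℕ.+ rk (A ∩ B) ≤ rk A ℕ.+ rk B

  rank : ℕ
  rank = rk ⊤

open Matroid public using (rk; rank)

take-⊆ : ∀ m {n} {A B : Subset (m ℕ.+ n)} → A ⊆ B → take m A ⊆ take m B
take-⊆ (suc m) {A = a ∷ A} {b ∷ B} A⊆B here with A⊆B here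
... | here = here
take-⊆ (suc m) {A = a ∷ A} {b ∷ B} A⊆B (there x∈A) =
  there (take-⊆ m {A = A} {B} (drop-∷-⊆ A⊆B) x∈A)

drop-⊆ : ∀ m {n} {A B : Subset (m ℕ.+ n)} → A ⊆ B → drop m A ⊆ drop m B
drop-⊆ zero    A⊆B x∈A = A⊆B x∈A
drop-⊆ (suc m) {A = a ∷ A} {b ∷ B} A⊆B x∈A =
  drop-⊆ m {A = A} {B} (drop-∷-⊆ A⊆B) x∈A

∣take∣+∣drop∣ : ∀ m {n} (A : Subset (m ℕ.+ n)) → ∣ take m A ∣ ℕ.+ ∣ drop m A ∣ ≡ ∣ A ∣
∣take∣+∣drop∣ zero    A           = refl
∣take∣+∣drop∣ (suc m) (true  ∷ A) = cong suc (∣take∣+∣drop∣ m A)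
∣take∣+∣drop∣ (suc m) (false ∷ A) = ∣take∣+∣drop∣ m A

-- The disjoint union of Fin m and Fin n is Fin (m + n), and for
-- A ⊆ Fin (m + n) the traces of A on the two summands are take m A and
-- drop m A.

infixr 6 _⊕_

_⊕_ : ∀ {m n} → Matroid m → Matroid n → Matroid (m ℕ.+ n)
_⊕_ {m} {n} M₁ M₂ = record
  { rk            = r
  ; rk-card       = r-card
  ; rk-mono       = λ {A} {B} A⊆B → ℕ.+-mono-≤
      (M₁.rk-mono (take-⊆ m {A = A} {B} A⊆B))
      (M₂.rk-mono (drop-⊆ m {A = A} {B} A⊆B))
  ; rk-submodular = r-submodular
  }
  where
  module M₁ = Matroid M₁
  module M₂ = Matroid M₂
  open ℕ.≤-Reasoning

  r : Subset (m ℕ.+ n) → ℕ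
  r A = M₁.rk (take m A) ℕ.+ M₂.rk (drop m A)

  r-card : ∀ A → r A ≤ ∣ A ∣
  r-card A = begin
    r A                             ≤⟨ ℕ.+-mono-≤ (M₁.rk-card (take m A)) (M₂.rk-card (drop m A)) ⟩
    ∣ take m A ∣ ℕ.+ ∣ drop m A ∣   ≡⟨ ∣take∣+∣drop∣ m A ⟩
    ∣ A ∣                           ∎

  r-submodular : ∀ A B → r (A ∪ B) ℕ.+ r (A ∩ B) ≤ r A ℕ.+ r B
  r-submodular A B = begin
    r (A ∪ B) ℕ.+ r (A ∩ B)
      ≡⟨ cong₂ ℕ._+_
           (cong₂ ℕ._+_ (cong M₁.rk (take-zipWith _ A B)) (cong M₂.rk (drop-zipWith {m = m} _ A B)))
           (cong₂ ℕ._+_ (cong M₁.rk (take-zipWith _ A B)) (cong M₂.rk (drop-zipWith {m = m} _ A B))) ⟩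
    (M₁.rk (A₁ ∪ B₁) ℕ.+ M₂.rk (A₂ ∪ B₂)) ℕ.+ (M₁.rk (A₁ ∩ B₁) ℕ.+ M₂.rk (A₂ ∩ B₂))
      ≡⟨ interchange (M₁.rk (A₁ ∪ B₁)) _ _ _ ⟩
    (M₁.rk (A₁ ∪ B₁) ℕ.+ M₁.rk (A₁ ∩ B₁)) ℕ.+ (M₂.rk (A₂ ∪ B₂) ℕ.+ M₂.rk (A₂ ∩ B₂))
      ≤⟨ ℕ.+-mono-≤ (M₁.rk-submodular A₁ B₁) (M₂.rk-submodular A₂ B₂) ⟩
    (M₁.rk A₁ ℕ.+ M₁.rk B₁) ℕ.+ (M₂.rk A₂ ℕ.+ M₂.rk B₂)
      ≡⟨ interchange (M₁.rk A₁) _ _ _ ⟩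
    r A ℕ.+ r B ∎
    where
    A₁ B₁ : Subset m
    A₁ = take m A
    B₁ = take m B
    A₂ B₂ : Subset n
    A₂ = drop m A
    B₂ = drop m B

-- All vectors of length k with entries from a list; applied to a list
-- without repetitions it has no repetitions.

vectors : ∀ {A : Set} → List A → (k : ℕ) → List (Vec A k)
vectors xs zero    = [] ∷ []
vectors xs (suc k) = List.cartesianProductWith _∷_ xs (vectors xs k)

subsets : (n : ℕ) → List (Subset n)
subsets n = vectors (outside ∷ inside ∷ []) n

-- Tuples (A₁ , … , Aₖ) of subsets of Fin n with A₁ ⊆ A₂ ⊆ ⋯ ⊆ Aₖ, each
-- listed once.

chains : (n k : ℕ) → List (Vec (Subset n) k)
chains n k = List.filter (linked? _⊆?_) (vectors (subsets n) k)

-- Polynomials in k variables with integer coefficients, as formal sums of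
-- terms c · t₁^e₁ ⋯ tₖ^eₖ.  Such sums are not normalised: exponents may
-- repeat and coefficients may vanish, so equality of polynomials is _≈ᴾ_,
-- equality of all coefficients.

Exponent : ℕ → Set
Exponent k = Vec ℕ k

Polynomial : ℕ → Set
Polynomial k = List (ℤ × Exponent k)

coeff : ∀ {k} → Polynomial k → Exponent k → ℤ
coeff p e =
  List.foldr ℤ._+_ 0ℤ (List.map proj₁ (List.filter (λ term → ≡-dec ℕ._≟_ (proj₂ term) e) p))

infix 4 _≈ᴾ_

_≈ᴾ_ : ∀ {k} → Polynomial k → Polynomial k → Set
p ≈ᴾ q = ∀ e → coeff p e ≡ coeff q e

mulTerm : ∀ {k} → ℤ × Exponent k → ℤ × Exponent k → ℤ × Exponent k
mulTerm (c , e) (d , f) = c ℤ.* d , Vec.zipWith ℕ._+_ e f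

ℤ[t] : ℕ → RawRing 0ℓ 0ℓ
ℤ[t] k = record
  { Carrier = Polynomial k
  ; _≈_     = _≈ᴾ_
  ; _+_     = List._++_
  ; _*_     = List.cartesianProductWith mulTerm
  ; -_      = List.map (λ (c , e) → ℤ.- c , e)
  ; 0#      = []
  ; 1#      = (1ℤ , replicate k 0) ∷ []
  }

var : ∀ {k} → Fin k → Polynomial k
var {k} i = (1ℤ , replicate k 0 [ i ]≔ 1) ∷ []

-- The truncated subtraction is exact, since rk A ≤ rank M for every A.

χ : ∀ {n} (k : ℕ) → Matroid n → Polynomial k
χ {n} k M = List.foldr _+_ 0# (List.map summand (chains n k))
  where
  open RawRing (ℤ[t] k)
  open RawSemiringDefinitions rawSemiring using (product; _^_)

  summand : Vec (Subset n) k → Polynomial k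
  summand A = product λ i →
    ((- 1#) ^ ∣ lookup A i ∣) * (var i ^ (rank M ∸ rk M (lookup A i)))

{-# OPTIONS --safe #-}

-- A chain in the disjoint union of the ground sets is the same as a pair of
-- chains, one in each of them.  Cardinality and corank are additive along this
-- bijection, so the monomial of a chain is the product of the monomials of its
-- two traces, and the double sum over pairs of chains factors by distributivity.

module Submission where

open import Defs
open import Algebra.Bundles using (CommutativeSemiring; RawRing)
open import Algebra.Structures using (IsCommutativeMonoid)
open import Algebra.Structures.Biased using (isCommutativeSemiringˡ)
import Algebra.Definitions.RawSemiring as RawSemiringDefinitions
import Algebra.Properties.CommutativeMonoid.Sum as Product
import Algebra.Properties.CommutativeSemigroup as CommutativeSemigroupProperties
open import Data.Bool.Base using (true; false; _∧_; if_then_else_)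
open import Data.Fin.Base using (Fin)
open import Data.Fin.Subset using (Subset; _⊆_; ∣_∣; ⊤)
open import Data.Fin.Subset.Properties using (_⊆?_; ⊆⊤; drop-∷-⊆)
open import Data.Integer.Base as ℤ using (ℤ; 0ℤ; 1ℤ)
import Data.Integer.Properties as ℤ
open import Data.List.Base as List using (List; []; _∷_; filter; cartesianProductWith)
open import Data.List.Properties using (++-assoc; ++-identityʳ; cartesianProductWith-distribʳ-++)
open import Data.Nat.Base as ℕ using (ℕ; zero; suc; _>_; _≤_; _∸_)
import Data.Nat.Properties as ℕ
open import Data.Product.Base using (_×_; _,_; proj₁; proj₂; uncurry)
open import Data.Vec.Base using (Vec; []; _∷_; _++_; take; drop; lookup; replicate; zipWith; here; there)
open import Data.Vec.Properties
  using (≡-dec; lookup-zipWith; take++drop≡id; ++-injectiveˡ; ++-injectiveʳ;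
         zipWith-assoc; zipWith-comm; zipWith-identityˡ)
open import Data.Vec.Relation.Unary.Linked using (Linked; linked?; []; [-]; _∷_)
open import Function.Base using (_∘_)
open import Function.Bundles using (mk⇔)
open import Level using (0ℓ)
open import Relation.Binary.PropositionalEquality
  using (_≡_; refl; sym; trans; cong; cong₂; subst₂; module ≡-Reasoning)
open import Relation.Binary.Structures using (IsEquivalence)
open import Relation.Nullary.Decidable using (does; _×-dec_; does-⇔)
open import Relation.Unary using (Pred; Decidable)

-- Finite sums over lists in a commutative semiring.

module ListSum {c ℓ} (R : CommutativeSemiring c ℓ) where

  open CommutativeSemiring R
    renaming (refl to ≈-refl; sym to ≈-sym; trans to ≈-trans)
  open CommutativeSemigroupProperties +-commutativeSemigroup using (interchange)
  open import Relation.Binary.Reasoning.Setoid setoid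

  private variable
    A B C : Set

  ∑ : List A → (A → Carrier) → Carrier
  ∑ xs f = List.foldr _+_ 0# (List.map f xs)

  ∑-cong : ∀ (xs : List A) {f g : A → Carrier} → (∀ x → f x ≈ g x) → ∑ xs f ≈ ∑ xs g
  ∑-cong []       f≈g = ≈-refl
  ∑-cong (x ∷ xs) f≈g = +-cong (f≈g x) (∑-cong xs f≈g)

  ∑-zero : ∀ (xs : List A) → ∑ xs (λ _ → 0#) ≈ 0#
  ∑-zero []       = ≈-refl
  ∑-zero (x ∷ xs) = ≈-trans (+-identityˡ _) (∑-zero xs)

  ∑-distrib-+ : ∀ (xs : List A) (f g : A → Carrier) → ∑ xs (λ x → f x + g x) ≈ ∑ xs f + ∑ xs g
  ∑-distrib-+ []       f g = ≈-sym (+-identityˡ 0#)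
  ∑-distrib-+ (x ∷ xs) f g = ≈-trans (+-congˡ (∑-distrib-+ xs f g)) (interchange _ _ _ _)

  ∑-comm : ∀ (xs : List A) (ys : List B) (f : A → B → Carrier) →
           ∑ xs (λ x → ∑ ys (f x)) ≈ ∑ ys (λ y → ∑ xs (λ x → f x y))
  ∑-comm []       ys f = ≈-sym (∑-zero ys)
  ∑-comm (x ∷ xs) ys f = ≈-trans (+-congˡ (∑-comm xs ys f)) (≈-sym (∑-distrib-+ ys _ _))

  *-distribˡ-∑ : ∀ a (xs : List A) (f : A → Carrier) → a * ∑ xs f ≈ ∑ xs (λ x → a * f x)
  *-distribˡ-∑ a []       f = zeroʳ a
  *-distribˡ-∑ a (x ∷ xs) f = ≈-trans (distribˡ a _ _) (+-congˡ (*-distribˡ-∑ a xs f))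

  *-distribʳ-∑ : ∀ a (xs : List A) (f : A → Carrier) → ∑ xs f * a ≈ ∑ xs (λ x → f x * a)
  *-distribʳ-∑ a []       f = zeroˡ a
  *-distribʳ-∑ a (x ∷ xs) f = ≈-trans (distribʳ a _ _) (+-congˡ (*-distribʳ-∑ a xs f))

  ∑-++ : ∀ (xs ys : List A) (f : A → Carrier) → ∑ (xs List.++ ys) f ≈ ∑ xs f + ∑ ys f
  ∑-++ []       ys f = ≈-sym (+-identityˡ _)
  ∑-++ (x ∷ xs) ys f = ≈-trans (+-congˡ (∑-++ xs ys f)) (≈-sym (+-assoc _ _ _))

  ∑-map : ∀ (h : A → B) (xs : List A) (f : B → Carrier) → ∑ (List.map h xs) f ≈ ∑ xs (f ∘ h)
  ∑-map h []       f = ≈-refl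
  ∑-map h (x ∷ xs) f = +-congˡ (∑-map h xs f)

  ∑-cartesianProductWith : ∀ (h : A → B → C) xs ys (f : C → Carrier) →
    ∑ (cartesianProductWith h xs ys) f ≈ ∑ xs (λ x → ∑ ys (λ y → f (h x y)))
  ∑-cartesianProductWith h []       ys f = ≈-refl
  ∑-cartesianProductWith h (x ∷ xs) ys f = ≈-trans (∑-++ (List.map (h x) ys) _ f)
    (+-cong (∑-map (h x) ys f) (∑-cartesianProductWith h xs ys f))

  -- Trades the filter for zero summands, so that the sum runs over the whole list and can be
  -- reindexed before the condition is examined.
  ∑-filter : ∀ {p} {P : Pred A p} (P? : Decidable P) xs (f : A → Carrier) →
    ∑ (filter P? xs) f ≈ ∑ xs (λ x → if does (P? x) then f x else 0#)
  ∑-filter P? []       f = ≈-refl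
  ∑-filter P? (x ∷ xs) f with does (P? x)
  ... | true  = +-congˡ (∑-filter P? xs f)
  ... | false = ≈-trans (∑-filter P? xs f) (≈-sym (+-identityˡ _))

  if-congᵗ : ∀ b {x y} → x ≈ y → (if b then x else 0#) ≈ (if b then y else 0#)
  if-congᵗ true  x≈y = x≈y
  if-congᵗ false x≈y = ≈-refl

  ∑-if : ∀ b (xs : List A) (f : A → Carrier) →
         ∑ xs (λ x → if b then f x else 0#) ≈ (if b then ∑ xs f else 0#)
  ∑-if true  xs f = ≈-refl
  ∑-if false xs f = ∑-zero xs

  -- For `xs` consisting of `outside` and `inside`, this is the correspondence between subsets of a
  -- disjoint union and pairs of subsets, in the form of a reindexed sum.
  ∑-vectors-++ : ∀ (xs : List A) m {n} (f : Vec A (m ℕ.+ n) → Carrier) →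
    ∑ (vectors xs (m ℕ.+ n)) f ≈ ∑ (vectors xs m) (λ v → ∑ (vectors xs n) (λ w → f (v ++ w)))
  ∑-vectors-++ xs zero    {n} f = ≈-sym (+-identityʳ _)
  ∑-vectors-++ xs (suc m) {n} f = begin
    ∑ (vectors xs (suc m ℕ.+ n)) f
      ≈⟨ ∑-cartesianProductWith _∷_ xs (vectors xs (m ℕ.+ n)) f ⟩
    ∑ xs (λ x → ∑ (vectors xs (m ℕ.+ n)) (λ u → f (x ∷ u)))
      ≈⟨ ∑-cong xs (λ x → ∑-vectors-++ xs m (λ u → f (x ∷ u))) ⟩
    ∑ xs (λ x → ∑ (vectors xs m) (λ v → ∑ (vectors xs n) (λ w → f (x ∷ v ++ w))))
      ≈⟨ ∑-cartesianProductWith _∷_ xs (vectors xs m) _ ⟨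
    ∑ (vectors xs (suc m)) (λ v → ∑ (vectors xs n) (λ w → f (v ++ w))) ∎

  -- The hypothesis says that `zs` enumerates the values `h x y` as far as any sum can tell. Sums
  -- are compared rather than lists because tuples over `zs` interleave the choices from `xs` and
  -- `ys`, so they come in a different order from pairs of tuples.
  ∑-vectors-zipWith : ∀ (h : A → B → C) xs ys zs →
    (∀ f → ∑ zs f ≈ ∑ xs (λ x → ∑ ys (λ y → f (h x y)))) →
    ∀ k (f : Vec C k → Carrier) →
    ∑ (vectors zs k) f ≈ ∑ (vectors xs k) (λ v → ∑ (vectors ys k) (λ w → f (zipWith h v w)))
  ∑-vectors-zipWith h xs ys zs eq zero    f = ≈-sym (+-identityʳ _)
  ∑-vectors-zipWith h xs ys zs eq (suc k) f = begin
    ∑ (vectors zs (suc k)) f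
      ≈⟨ ∑-cartesianProductWith _∷_ zs (vectors zs k) f ⟩
    ∑ zs (λ z → ∑ (vectors zs k) (λ u → f (z ∷ u)))
      ≈⟨ eq _ ⟩
    ∑ xs (λ x → ∑ ys (λ y → ∑ (vectors zs k) (λ u → f (h x y ∷ u))))
      ≈⟨ ∑-cong xs (λ x → ∑-cong ys (λ y → ∑-vectors-zipWith h xs ys zs eq k _)) ⟩
    ∑ xs (λ x → ∑ ys (λ y → ∑ (vectors xs k) (λ v → ∑ (vectors ys k) (λ w → f (h x y ∷ zipWith h v w)))))
      -- The head `y` of the second tuple has to move past the tail `v` of the first, so that `y`
      -- and `w` can join into one tuple.
      ≈⟨ ∑-cong xs (λ x → ∑-comm ys (vectors xs k) _) ⟩
    ∑ xs (λ x → ∑ (vectors xs k) (λ v → ∑ ys (λ y → ∑ (vectors ys k) (λ w → f (h x y ∷ zipWith h v w)))))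
      ≈⟨ ∑-cong xs (λ x → ∑-cong (vectors xs k) (λ v →
           ≈-sym (∑-cartesianProductWith _∷_ ys (vectors ys k) _))) ⟩
    ∑ xs (λ x → ∑ (vectors xs k) (λ v → ∑ (vectors ys (suc k)) (λ w → f (zipWith h (x ∷ v) w))))
      ≈⟨ ∑-cartesianProductWith _∷_ xs (vectors xs k) _ ⟨
    ∑ (vectors xs (suc k)) (λ v → ∑ (vectors ys (suc k)) (λ w → f (zipWith h v w))) ∎

-- Subsets of a disjoint union, their inclusions and chains.

take-++ : ∀ {A : Set} {m n} (xs : Vec A m) (ys : Vec A n) → take m (xs ++ ys) ≡ xs
take-++ {m = m} xs ys = ++-injectiveˡ _ xs (take++drop≡id m (xs ++ ys))

drop-++ : ∀ {A : Set} {m n} (xs : Vec A m) (ys : Vec A n) → drop m (xs ++ ys) ≡ ys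
drop-++ {m = m} xs ys = ++-injectiveʳ (take m (xs ++ ys)) xs (take++drop≡id m (xs ++ ys))

++-⊤ : ∀ m {n} → ⊤ {m ℕ.+ n} ≡ ⊤ {m} ++ ⊤ {n}
++-⊤ zero    = refl
++-⊤ (suc m) = cong (true ∷_) (++-⊤ m)

∣++∣ : ∀ {m n} (A : Subset m) (B : Subset n) → ∣ A ++ B ∣ ≡ ∣ A ∣ ℕ.+ ∣ B ∣
∣++∣ {m} A B = begin
  ∣ A ++ B ∣                                  ≡⟨ ∣take∣+∣drop∣ m (A ++ B) ⟨
  ∣ take m (A ++ B) ∣ ℕ.+ ∣ drop m (A ++ B) ∣ ≡⟨ cong₂ (λ A B → ∣ A ∣ ℕ.+ ∣ B ∣) (take-++ A B) (drop-++ A B) ⟩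
  ∣ A ∣ ℕ.+ ∣ B ∣                             ∎
  where open ≡-Reasoning

++-⊆ : ∀ {m n} {A A′ : Subset m} {B B′ : Subset n} → A ⊆ A′ → B ⊆ B′ → A ++ B ⊆ A′ ++ B′
++-⊆ {A = []}    {[]}     A⊆A′ B⊆B′ x∈B = B⊆B′ x∈B
++-⊆ {A = a ∷ A} {b ∷ A′} A⊆A′ B⊆B′ here with here ← A⊆A′ here = here
++-⊆ {A = a ∷ A} {b ∷ A′} A⊆A′ B⊆B′ (there x∈) = there (++-⊆ (drop-∷-⊆ A⊆A′) B⊆B′ x∈)

-- Inclusion passes to traces, and the traces of `A ++ B` are `A` and `B`.
++-⊆⁻ : ∀ {m n} {A A′ : Subset m} {B B′ : Subset n} → A ++ B ⊆ A′ ++ B′ → A ⊆ A′ × B ⊆ B′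
++-⊆⁻ {m} {A = A} {A′} {B} {B′} ⊆′ =
  subst₂ _⊆_ (take-++ A B) (take-++ A′ B′) (take-⊆ m {A = A ++ B} {A′ ++ B′} ⊆′) ,
  subst₂ _⊆_ (drop-++ A B) (drop-++ A′ B′) (drop-⊆ m {A = A ++ B} {A′ ++ B′} ⊆′)

Linked-⊆-++⁺ : ∀ {m n k} {As : Vec (Subset m) k} {Bs : Vec (Subset n) k} →
  Linked _⊆_ As → Linked _⊆_ Bs → Linked _⊆_ (zipWith _++_ As Bs)
Linked-⊆-++⁺ []  []  = []
Linked-⊆-++⁺ [-] [-] = [-]
Linked-⊆-++⁺ {As = _ ∷ _ ∷ _} {_ ∷ _ ∷ _} (A⊆ ∷ As) (B⊆ ∷ Bs) = ++-⊆ A⊆ B⊆ ∷ Linked-⊆-++⁺ As Bs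

-- Together with `Linked-⊆-++⁺` this gives the bijection between chains and pairs of chains, as an
-- equivalence of the conditions by which `chains` filters.
Linked-⊆-++⁻ : ∀ {m n k} {As : Vec (Subset m) k} {Bs : Vec (Subset n) k} →
  Linked _⊆_ (zipWith _++_ As Bs) → Linked _⊆_ As × Linked _⊆_ Bs
Linked-⊆-++⁻ {As = []}        {[]}        []  = [] , []
Linked-⊆-++⁻ {As = _ ∷ []}    {_ ∷ []}    [-] = [-] , [-]
Linked-⊆-++⁻ {As = _ ∷ _ ∷ _} {_ ∷ _ ∷ _} (⊆′ ∷ Cs) =
  let A⊆ , B⊆ = ++-⊆⁻ ⊆′ ; As , Bs = Linked-⊆-++⁻ Cs in A⊆ ∷ As , B⊆ ∷ Bs

-- Sums over chains in a disjoint union.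

module ChainSum {c ℓ} (R : CommutativeSemiring c ℓ) where

  open CommutativeSemiring R using (Carrier; _≈_; 0#; setoid; reflexive)
  open ListSum R
  open import Relation.Binary.Reasoning.Setoid setoid

  if-∧ : ∀ a b {x : Carrier} →
    (if a ∧ b then x else 0#) ≡ (if a then (if b then x else 0#) else 0#)
  if-∧ true  b = refl
  if-∧ false b = refl

  -- Arbitrary tuples split into pairs without any condition. So the chain condition is first moved
  -- into the summand, the sum over all tuples is reindexed, and the condition, now a conjunction,
  -- is turned back into one filter for `As` and one for `Bs`.
  ∑-chains-++ : ∀ m n k (f : Vec (Subset (m ℕ.+ n)) k → Carrier) →
    ∑ (chains (m ℕ.+ n) k) f ≈
    ∑ (chains m k) (λ As → ∑ (chains n k) (λ Bs → f (zipWith _++_ As Bs)))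
  ∑-chains-++ m n k f = begin
    ∑ (chains (m ℕ.+ n) k) f
      ≈⟨ ∑-filter chain? (tuples (m ℕ.+ n)) f ⟩
    ∑ (tuples (m ℕ.+ n)) (λ Cs → if does (chain? Cs) then f Cs else 0#)
      ≈⟨ ∑-vectors-zipWith _++_ (subsets m) (subsets n) (subsets (m ℕ.+ n)) (∑-vectors-++ _ m) k _ ⟩
    ∑ (tuples m) (λ As → ∑ (tuples n) (λ Bs →
      if does (chain? (zipWith _++_ As Bs)) then f (zipWith _++_ As Bs) else 0#))
      ≈⟨ ∑-cong (tuples m) (λ As → ∑-cong (tuples n) (λ Bs → reflexive (split As Bs))) ⟩
    ∑ (tuples m) (λ As → ∑ (tuples n) (λ Bs →
      if does (chain? As) then (if does (chain? Bs) then f (zipWith _++_ As Bs) else 0#) else 0#))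
      ≈⟨ ∑-cong (tuples m) (λ As → ∑-if (does (chain? As)) (tuples n) _) ⟩
    ∑ (tuples m) (λ As → if does (chain? As) then
      ∑ (tuples n) (λ Bs → if does (chain? Bs) then f (zipWith _++_ As Bs) else 0#) else 0#)
      ≈⟨ ∑-cong (tuples m) (λ As → if-congᵗ (does (chain? As)) (∑-filter chain? (tuples n) _)) ⟨
    ∑ (tuples m) (λ As → if does (chain? As) then
      ∑ (chains n k) (λ Bs → f (zipWith _++_ As Bs)) else 0#)
      ≈⟨ ∑-filter chain? (tuples m) _ ⟨
    ∑ (chains m k) (λ As → ∑ (chains n k) (λ Bs → f (zipWith _++_ As Bs))) ∎
    where
    tuples : ∀ n → List (Vec (Subset n) k)
    tuples n = vectors (subsets n) k

    chain? : ∀ {n} → Decidable (Linked (_⊆_ {n}) {k})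
    chain? = linked? _⊆?_

    split : ∀ As Bs →
      (if does (chain? (zipWith _++_ As Bs)) then f (zipWith _++_ As Bs) else 0#) ≡
      (if does (chain? As) then (if does (chain? Bs) then f (zipWith _++_ As Bs) else 0#) else 0#)
    -- Decisions of equivalent propositions have the same truth value, and that of a product is the
    -- conjunction of the two truth values.
    split As Bs = trans
      (cong (if_then f (zipWith _++_ As Bs) else 0#)
        (does-⇔ (mk⇔ Linked-⊆-++⁻ (uncurry Linked-⊆-++⁺)) (chain? (zipWith _++_ As Bs)) (chain? As ×-dec chain? Bs)))
      (if-∧ (does (chain? As)) (does (chain? Bs)))

-- Formal polynomials as a commutative semiring modulo `_∼_`.

open ListSum ℤ.+-*-commutativeSemiring

-- The linear extension of g to formal sums.  Quantifying over all g gives an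
-- equivalence for which the semiring laws reduce to manipulations of sums,
-- and taking g to be an indicator function recovers _≈ᴾ_.

⟦_⟧ : ∀ {k} → Polynomial k → (Exponent k → ℤ) → ℤ
⟦ p ⟧ g = ∑ p (λ (c , e) → c ℤ.* g e)

infix 4 _∼_

_∼_ : ∀ {k} → Polynomial k → Polynomial k → Set
p ∼ q = ∀ g → ⟦ p ⟧ g ≡ ⟦ q ⟧ g

∼⇒≈ᴾ : ∀ {k} (p q : Polynomial k) → p ∼ q → p ≈ᴾ q
∼⇒≈ᴾ p q p∼q e = trans (coeff-⟦⟧ p) (trans (p∼q δ) (sym (coeff-⟦⟧ q)))
  where
  δ : Exponent _ → ℤ
  δ f = if does (≡-dec ℕ._≟_ f e) then 1ℤ else 0ℤ

  if-1-else-0 : ∀ b {c} → (if b then c else 0ℤ) ≡ c ℤ.* (if b then 1ℤ else 0ℤ)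
  if-1-else-0 true  = sym (ℤ.*-identityʳ _)
  if-1-else-0 false {c} = sym (ℤ.*-zeroʳ c)

  coeff-⟦⟧ : ∀ p → coeff p e ≡ ⟦ p ⟧ δ
  coeff-⟦⟧ p = trans
    (∑-filter (λ term → ≡-dec ℕ._≟_ (proj₂ term) e) p proj₁)
    (∑-cong p (λ (c , f) → if-1-else-0 (does (≡-dec ℕ._≟_ f e))))

∼-isEquivalence : ∀ {k} → IsEquivalence (_∼_ {k})
∼-isEquivalence = record
  { refl  = λ g → refl
  ; sym   = λ p∼q g → sym (p∼q g)
  ; trans = λ p∼q q∼r g → trans (p∼q g) (q∼r g)
  }

≡⇒∼ : ∀ {k} {p q : Polynomial k} → p ≡ q → p ∼ q
≡⇒∼ refl g = refl

module _ {k : ℕ} where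

  open RawRing (ℤ[t] k) using (_+_; _*_; 0#; 1#)
  open ≡-Reasoning

  +-isCommutativeMonoid : IsCommutativeMonoid _∼_ _+_ 0#
  +-isCommutativeMonoid = record
    { isMonoid = record
      { isSemigroup = record
        { isMagma = record
          { isEquivalence = ∼-isEquivalence
          ; ∙-cong = λ {p} {p′} {q} {q′} p∼p′ q∼q′ g →
              trans (∑-++ p q _) (trans (cong₂ ℤ._+_ (p∼p′ g) (q∼q′ g)) (sym (∑-++ p′ q′ _)))
          }
        ; assoc = λ p q r → ≡⇒∼ (++-assoc p q r)
        }
      ; identity = (λ p g → refl) , (λ p → ≡⇒∼ (++-identityʳ p))
      }
    ; comm = λ p q g → trans (∑-++ p q _) (trans (ℤ.+-comm (⟦ p ⟧ g) _) (sym (∑-++ q p _)))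
    }

  mulTerm-assoc : ∀ (x y z : ℤ × Exponent k) → mulTerm (mulTerm x y) z ≡ mulTerm x (mulTerm y z)
  mulTerm-assoc (c , e) (c′ , e′) (c″ , e″) =
    cong₂ _,_ (ℤ.*-assoc c c′ c″) (zipWith-assoc ℕ.+-assoc e e′ e″)

  mulTerm-comm : ∀ (x y : ℤ × Exponent k) → mulTerm x y ≡ mulTerm y x
  mulTerm-comm (c , e) (c′ , e′) = cong₂ _,_ (ℤ.*-comm c c′) (zipWith-comm ℕ.+-comm e e′)

  mulTerm-identityˡ : ∀ (x : ℤ × Exponent k) → mulTerm (1ℤ , replicate k 0) x ≡ x
  mulTerm-identityˡ (c , e) = cong₂ _,_ (ℤ.*-identityˡ c) (zipWith-identityˡ ℕ.+-identityˡ e)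

  -- Each law for products reduces to the same law for `mulTerm`, applied term by term. No linearity
  -- is involved, so `f` may be any function of terms.
  *-assoc-∑ : ∀ (p q r : Polynomial k) (f : ℤ × Exponent k → ℤ) → ∑ ((p * q) * r) f ≡ ∑ (p * (q * r)) f
  *-assoc-∑ p q r f = begin
    ∑ ((p * q) * r) f
      ≡⟨ ∑-cartesianProductWith mulTerm (p * q) r f ⟩
    ∑ (p * q) (λ u → ∑ r (λ z → f (mulTerm u z)))
      ≡⟨ ∑-cartesianProductWith mulTerm p q _ ⟩
    ∑ p (λ x → ∑ q (λ y → ∑ r (λ z → f (mulTerm (mulTerm x y) z))))
      ≡⟨ ∑-cong p (λ x → ∑-cong q (λ y → ∑-cong r (λ z → cong f (mulTerm-assoc x y z)))) ⟩
    ∑ p (λ x → ∑ q (λ y → ∑ r (λ z → f (mulTerm x (mulTerm y z)))))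
      ≡⟨ ∑-cong p (λ x → ∑-cartesianProductWith mulTerm q r _) ⟨
    ∑ p (λ x → ∑ (q * r) (λ v → f (mulTerm x v)))
      ≡⟨ ∑-cartesianProductWith mulTerm p (q * r) f ⟨
    ∑ (p * (q * r)) f ∎

  *-comm-∑ : ∀ (p q : Polynomial k) (f : ℤ × Exponent k → ℤ) → ∑ (p * q) f ≡ ∑ (q * p) f
  *-comm-∑ p q f = begin
    ∑ (p * q) f                              ≡⟨ ∑-cartesianProductWith mulTerm p q f ⟩
    ∑ p (λ x → ∑ q (λ y → f (mulTerm x y)))  ≡⟨ ∑-comm p q _ ⟩
    ∑ q (λ y → ∑ p (λ x → f (mulTerm x y)))  ≡⟨ ∑-cong q (λ y → ∑-cong p (λ x → cong f (mulTerm-comm x y))) ⟩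
    ∑ q (λ y → ∑ p (λ x → f (mulTerm y x)))  ≡⟨ ∑-cartesianProductWith mulTerm q p f ⟨
    ∑ (q * p) f                              ∎

  *-identityˡ-∑ : ∀ (p : Polynomial k) (f : ℤ × Exponent k → ℤ) → ∑ (1# * p) f ≡ ∑ p f
  *-identityˡ-∑ p f = begin
    ∑ (1# * p) f                                       ≡⟨ ∑-cartesianProductWith mulTerm 1# p f ⟩
    ∑ p (λ y → f (mulTerm (1ℤ , replicate k 0) y)) ℤ.+ 0ℤ ≡⟨ ℤ.+-identityʳ _ ⟩
    ∑ p (λ y → f (mulTerm (1ℤ , replicate k 0) y))     ≡⟨ ∑-cong p (λ y → cong f (mulTerm-identityˡ y)) ⟩
    ∑ p f                                              ∎

  -- Multiplication by a term `(c , e)` can be absorbed into the test function: `g` is shifted by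
  -- `e` and the value scaled by `c`. The hypothesis is then used at the shifted functions, which is
  -- why `_∼_` quantifies over every `g`.
  *-congˡ-∼ : ∀ (p : Polynomial k) {q q′} → q ∼ q′ → p * q ∼ p * q′
  *-congˡ-∼ p {q} {q′} q∼q′ g = begin
    ⟦ p * q ⟧ g
      ≡⟨ expand q ⟩
    ∑ p (λ (c , e) → c ℤ.* ⟦ q ⟧ (g ∘ zipWith ℕ._+_ e))
      ≡⟨ ∑-cong p (λ (c , e) → cong (c ℤ.*_) (q∼q′ (g ∘ zipWith ℕ._+_ e))) ⟩
    ∑ p (λ (c , e) → c ℤ.* ⟦ q′ ⟧ (g ∘ zipWith ℕ._+_ e))
      ≡⟨ expand q′ ⟨
    ⟦ p * q′ ⟧ g ∎
    where
    expand : ∀ q → ⟦ p * q ⟧ g ≡ ∑ p (λ (c , e) → c ℤ.* ⟦ q ⟧ (g ∘ zipWith ℕ._+_ e))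
    expand q = trans (∑-cartesianProductWith mulTerm p q _) (∑-cong p (λ (c , e) →
      trans (∑-cong q (λ (d , f) → ℤ.*-assoc c d _)) (sym (*-distribˡ-∑ c q _))))

  *-cong-∼ : ∀ {p p′ q q′ : Polynomial k} → p ∼ p′ → q ∼ q′ → p * q ∼ p′ * q′
  *-cong-∼ {p} {p′} {q} {q′} p∼p′ q∼q′ g = begin
    ⟦ p * q ⟧ g    ≡⟨ *-congˡ-∼ p {q} {q′} q∼q′ g ⟩
    ⟦ p * q′ ⟧ g   ≡⟨ *-comm-∑ p q′ _ ⟩
    ⟦ q′ * p ⟧ g   ≡⟨ *-congˡ-∼ q′ {p} {p′} p∼p′ g ⟩
    ⟦ q′ * p′ ⟧ g  ≡⟨ *-comm-∑ q′ p′ _ ⟩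
    ⟦ p′ * q′ ⟧ g  ∎

  *-isCommutativeMonoid : IsCommutativeMonoid _∼_ _*_ 1#
  *-isCommutativeMonoid = record
    { isMonoid = record
      { isSemigroup = record
        { isMagma = record
          { isEquivalence = ∼-isEquivalence
          ; ∙-cong = λ {p} {p′} {q} {q′} → *-cong-∼ {p} {p′} {q} {q′}
          }
        ; assoc = λ p q r g → *-assoc-∑ p q r _
        }
      ; identity = (λ p g → *-identityˡ-∑ p _)
                 , (λ p g → trans (*-comm-∑ p 1# _) (*-identityˡ-∑ p _))
      }
    ; comm = λ p q g → *-comm-∑ p q _
    }

-- The operations are those of `ℤ[t] k`; only the equality is `_∼_` in place of `_≈ᴾ_`.
polynomialSemiring : ℕ → CommutativeSemiring 0ℓ 0ℓ
polynomialSemiring k = record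
  { isCommutativeSemiring = isCommutativeSemiringˡ record
    { +-isCommutativeMonoid = +-isCommutativeMonoid {k}
    ; *-isCommutativeMonoid = *-isCommutativeMonoid
    -- On this side distributivity is an equality of lists, since the left factor drives the outer
    -- iteration; the other side follows by commutativity.
    ; distribʳ = λ r p q → ≡⇒∼ (cartesianProductWith-distribʳ-++ mulTerm p q r)
    ; zeroˡ    = λ p g → refl
    }
  }

-- Additivity of the corank.

-- The bounds rule out truncation: `0 ∸ 1` and `1 ∸ 0` add up to 1, whereas `1 ∸ 1` is 0.
∸-interchange : ∀ {a b c d} → c ≤ a → d ≤ b → (a ℕ.+ b) ∸ (c ℕ.+ d) ≡ (a ∸ c) ℕ.+ (b ∸ d)
∸-interchange {a} {b} {c} {d} c≤a d≤b = begin
  (a ℕ.+ b) ∸ (c ℕ.+ d)    ≡⟨ ℕ.∸-+-assoc (a ℕ.+ b) c d ⟨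
  ((a ℕ.+ b) ∸ c) ∸ d      ≡⟨ cong (_∸ d) (ℕ.+-∸-comm b c≤a) ⟩
  ((a ∸ c) ℕ.+ b) ∸ d      ≡⟨ ℕ.+-∸-assoc (a ∸ c) d≤b ⟩
  (a ∸ c) ℕ.+ (b ∸ d)      ∎
  where open ≡-Reasoning

corank : ∀ {n} → Matroid n → Subset n → ℕ
corank M A = rank M ∸ rk M A

rk-⊕ : ∀ {m n} (M₁ : Matroid m) (M₂ : Matroid n) A B → rk (M₁ ⊕ M₂) (A ++ B) ≡ rk M₁ A ℕ.+ rk M₂ B
rk-⊕ M₁ M₂ A B = cong₂ (λ A B → rk M₁ A ℕ.+ rk M₂ B) (take-++ A B) (drop-++ A B)

corank-⊕ : ∀ {m n} (M₁ : Matroid m) (M₂ : Matroid n) A B →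
  corank (M₁ ⊕ M₂) (A ++ B) ≡ corank M₁ A ℕ.+ corank M₂ B
corank-⊕ {m} M₁ M₂ A B = trans
  -- The full ground set is `⊤ ++ ⊤`, so the rank of the sum splits like any other value of `rk`.
  -- The bounds needed for the subtraction come from monotonicity below `⊤`.
  (cong₂ _∸_ (trans (cong (rk (M₁ ⊕ M₂)) (++-⊤ m)) (rk-⊕ M₁ M₂ ⊤ ⊤)) (rk-⊕ M₁ M₂ A B))
  (∸-interchange (Matroid.rk-mono M₁ ⊆⊤) (Matroid.rk-mono M₂ ⊆⊤))

-- Multiplicativity of the monomials and of `χ`.

module _ (k : ℕ) where

  open RawRing (ℤ[t] k) using (-_; rawSemiring)
  open CommutativeSemiring (polynomialSemiring k)
    using (_*_; 1#; setoid; *-identityˡ; *-assoc; *-cong; *-commutativeMonoid; *-commutativeSemigroup)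
  open RawSemiringDefinitions rawSemiring using (_^_)
  -- In the multiplicative monoid the generic sum over `Fin k` is a product, and its additivity says
  -- that a product of pointwise products factors.
  open Product *-commutativeMonoid using ()
    renaming (sum to product; ∑-distrib-+ to ∏-distrib-*; sum-cong-≋ to product-cong)
  open CommutativeSemigroupProperties *-commutativeSemigroup using (interchange)
  module S = ListSum (polynomialSemiring k)
  open import Relation.Binary.Reasoning.Setoid setoid

  -- Algebra.Properties.Semiring.Exp does not apply: its _^_ is parametrised by a
  -- raw semiring whose equality is _∼_, whereas the powers in χ are taken in ℤ[t] k.
  ^-homo-* : ∀ p a b → p ^ (a ℕ.+ b) ∼ (p ^ a) * (p ^ b)
  ^-homo-* p zero    b = begin
    p ^ b       ≈⟨ *-identityˡ (p ^ b) ⟨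
    1# * (p ^ b) ∎
  ^-homo-* p (suc a) b = begin
    p * (p ^ (a ℕ.+ b))      ≈⟨ *-congˡ-∼ p {p ^ (a ℕ.+ b)} {(p ^ a) * (p ^ b)} (^-homo-* p a b) ⟩
    p * ((p ^ a) * (p ^ b))  ≈⟨ *-assoc p (p ^ a) (p ^ b) ⟨
    (p ^ suc a) * (p ^ b)    ∎

  factor : ∀ {n} → Matroid n → Fin k → Subset n → Polynomial k
  factor M i A = ((- 1#) ^ ∣ A ∣) * (var i ^ corank M A)

  -- Repeats the term local to `χ`, so that `χ k M` is by definition the sum of `summand M` over the
  -- chains.
  summand : ∀ {n} → Matroid n → Vec (Subset n) k → Polynomial k
  summand M As = product λ i → factor M i (lookup As i)

  module _ {m n} (M₁ : Matroid m) (M₂ : Matroid n) where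

    factor-⊕ : ∀ i A B → factor (M₁ ⊕ M₂) i (A ++ B) ∼ factor M₁ i A * factor M₂ i B
    factor-⊕ i A B = begin
      ((- 1#) ^ ∣ A ++ B ∣) * (var i ^ corank (M₁ ⊕ M₂) (A ++ B))
        ≡⟨ cong₂ (λ a b → ((- 1#) ^ a) * (var i ^ b)) (∣++∣ A B) (corank-⊕ M₁ M₂ A B) ⟩
      ((- 1#) ^ (∣ A ∣ ℕ.+ ∣ B ∣)) * (var i ^ (corank M₁ A ℕ.+ corank M₂ B))
        ≈⟨ *-cong {(- 1#) ^ (∣ A ∣ ℕ.+ ∣ B ∣)} {((- 1#) ^ ∣ A ∣) * ((- 1#) ^ ∣ B ∣)}
                  {var i ^ (corank M₁ A ℕ.+ corank M₂ B)} {(var i ^ corank M₁ A) * (var i ^ corank M₂ B)}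
             (^-homo-* (- 1#) ∣ A ∣ ∣ B ∣) (^-homo-* (var i) (corank M₁ A) (corank M₂ B)) ⟩
      (((- 1#) ^ ∣ A ∣) * ((- 1#) ^ ∣ B ∣)) * ((var i ^ corank M₁ A) * (var i ^ corank M₂ B))
        ≈⟨ interchange ((- 1#) ^ ∣ A ∣) ((- 1#) ^ ∣ B ∣) (var i ^ corank M₁ A) (var i ^ corank M₂ B) ⟩
      factor M₁ i A * factor M₂ i B ∎

    summand-⊕ : ∀ As Bs → summand (M₁ ⊕ M₂) (zipWith _++_ As Bs) ∼ summand M₁ As * summand M₂ Bs
    summand-⊕ As Bs = begin
      summand (M₁ ⊕ M₂) (zipWith _++_ As Bs)
        ≈⟨ product-cong {x = λ i → factor (M₁ ⊕ M₂) i (lookup (zipWith _++_ As Bs) i)} {y = fg} pointwise ⟩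
      product fg
        ≈⟨ ∏-distrib-* (λ i → factor M₁ i (lookup As i)) (λ i → factor M₂ i (lookup Bs i)) ⟩
      summand M₁ As * summand M₂ Bs ∎
      where
      fg : Fin k → Polynomial k
      fg i = factor M₁ i (lookup As i) * factor M₂ i (lookup Bs i)

      pointwise : ∀ i → factor (M₁ ⊕ M₂) i (lookup (zipWith _++_ As Bs) i) ∼ fg i
      pointwise i rewrite lookup-zipWith _++_ i As Bs = factor-⊕ i (lookup As i) (lookup Bs i)

    χ-⊕ : χ k (M₁ ⊕ M₂) ∼ χ k M₁ * χ k M₂
    χ-⊕ = begin
      S.∑ (chains (m ℕ.+ n) k) (summand (M₁ ⊕ M₂))
        ≈⟨ ChainSum.∑-chains-++ (polynomialSemiring k) m n k (summand (M₁ ⊕ M₂)) ⟩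
      S.∑ (chains m k) (λ As → S.∑ (chains n k) (λ Bs → summand (M₁ ⊕ M₂) (zipWith _++_ As Bs)))
        ≈⟨ S.∑-cong (chains m k) (λ As → S.∑-cong (chains n k) (λ Bs → summand-⊕ As Bs)) ⟩
      S.∑ (chains m k) (λ As → S.∑ (chains n k) (λ Bs → summand M₁ As * summand M₂ Bs))
        ≈⟨ S.∑-cong (chains m k) (λ As → S.*-distribˡ-∑ (summand M₁ As) (chains n k) (summand M₂)) ⟨
      S.∑ (chains m k) (λ As → summand M₁ As * χ k M₂)
        ≈⟨ S.*-distribʳ-∑ (χ k M₂) (chains m k) (summand M₁) ⟨
      χ k M₁ * χ k M₂ ∎

corollary1p6 : ∀ {m n : ℕ} (M₁ : Matroid m) (M₂ : Matroid n) (k : ℕ) → k > 0 →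
    let open RawRing (ℤ[t] k) in χ k (M₁ ⊕ M₂) ≈ χ k M₁ * χ k M₂
-- All the algebra takes place modulo `_∼_`; only the finished identity is read off coefficientwise.
corollary1p6 M₁ M₂ k _ = ∼⇒≈ᴾ (χ k (M₁ ⊕ M₂)) (χ k M₁ * χ k M₂) (χ-⊕ k M₁ M₂)
  where open RawRing (ℤ[t] k) using (_*_)
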